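{- Let $m\geq 0$ and $k\geq 1$ be integers. If $\lambda$ is a partition with exactly $m$ $k$-hooks (i.e. $\alpha_k(\lambda)=m$), then \[ |\lambda|\geq t(m,k)= m\left(\left\lfloor \frac{m}{k}\right\rfloor +1\right)k-\binom{\lfloor m/k\rfloor +1}{2}k^2. \]
   Context: For a partition $\lambda=(\lambda_1\geq\cdots\geq\lambda_r>0)$, $|\lambda|=\sum_i\lambda_i$ is its weight. For a cell $u$ of the Young diagram of $\lambda$, the hook length of $u$ is the number of cells $v$ of the diagram with $v=u$, or $v$ below $u$ in the same column, or $v$ to the right of $u$ in the same row. $\alpha_k(\lambda)$ is the number of cells of the Young diagram of $\lambda$ with hook length exactly $k$ (the number of $k$-hooks). The number $t(m,k)$ is the weight of the partition with $m$ parts, writing $m=lk+r$ with $0\le r\le k-1$, consisting of $r$ parts equal to $(l+1)k$ followed by $k$ parts equal to $jk$ for each $j=l,l-1,\dots,1$. -}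

module Defs where

open import Data.List.Base using (List; []; _∷_; _++_; map; filter; length; replicate; upTo)
open import Data.List.Relation.Unary.All as All using (All; []; _∷_)
import Data.List.Relation.Unary.All.Properties as All
open import Data.List.Relation.Unary.Linked using (Linked; []; [-]; _∷_)
open import Data.Nat.Base using (ℕ; zero; suc; _+_; _*_; _≤_; _≥_; _<_; _/_; _%_; NonZero; >-nonZero⁻¹)
open import Data.Nat.ListAction using (sum)
open import Data.Nat.Properties using (_≟_; _<?_; ≤-refl; ≤-trans; *-monoˡ-≤; n≤1+n; m*n≢0)
open import Data.Product.Base using (_×_; _,_; map₁; proj₁; proj₂)
open import Data.Product.Properties using (≡-dec)
open import Data.Sum.Base using (_⊎_)
open import Relation.Binary.PropositionalEquality.Core using (_≡_)
open import Relation.Nullary.Decidable using (Dec; _×-dec_; _⊎-dec_)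

record Partition : Set where
  constructor mkPartition
  field
    parts      : List ℕ
    decreasing : Linked _≥_ parts
    positive   : All (0 <_) parts

open Partition public

weight : Partition → ℕ
weight λ′ = sum (parts λ′)

-- A cell is a pair (row , column), both counted from 0, with row 0 the
-- first (top) row; row i holds the columns 0, …, λᵢ₊₁ - 1.
Cell : Set
Cell = ℕ × ℕ

row col : Cell → ℕ
row = proj₁
col = proj₂

-- Each cell occurs exactly once, so lengths of filtered sublists are
-- cardinalities.
diagram : List ℕ → List Cell
diagram []       = []
diagram (p ∷ ps) = map (0 ,_) (upTo p) ++ map (map₁ suc) (diagram ps)

cells : Partition → List Cell
cells λ′ = diagram (parts λ′)

Below : Cell → Cell → Set
Below u v = row u < row v × col v ≡ col u

RightOf : Cell → Cell → Set
RightOf u v = row v ≡ row u × col u < col v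

-- InHook u v: the cell v belongs to the hook with corner u.
InHook : Cell → Cell → Set
InHook u v = v ≡ u ⊎ Below u v ⊎ RightOf u v

inHook? : ∀ u v → Dec (InHook u v)
inHook? u v =
  ≡-dec _≟_ _≟_ v u
    ⊎-dec ((row u <? row v) ×-dec (col v ≟ col u))
    ⊎-dec ((row v ≟ row u) ×-dec (col u <? col v))

hookLength : Partition → Cell → ℕ
hookLength λ′ u = length (filter (inHook? u) (cells λ′))

α : ℕ → Partition → ℕ
α k λ′ = length (filter (λ u → hookLength λ′ u ≟ k) (cells λ′))

-- k parts equal to j * k for each j = l, l - 1, …, 1.
staircase : ℕ → ℕ → List ℕ
staircase k zero    = []
staircase k (suc l) = replicate k (suc l * k) ++ staircase k l

private
  replicate-++-decreasing : ∀ n {x ys} → All (_≤ x) ys → Linked _≥_ ys →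
                            Linked _≥_ (replicate n x ++ ys)
  replicate-++-decreasing zero          ys≤x       ys↘ = ys↘
  replicate-++-decreasing (suc zero)    []         ys↘ = [-]
  replicate-++-decreasing (suc zero)    (y≤x ∷ _)  ys↘ = y≤x ∷ ys↘
  replicate-++-decreasing (suc (suc n)) ys≤x       ys↘ =
    ≤-refl ∷ replicate-++-decreasing (suc n) ys≤x ys↘

  staircase-≤ : ∀ k l → All (_≤ l * k) (staircase k l)
  staircase-≤1+ : ∀ k l → All (_≤ suc l * k) (staircase k l)

  staircase-≤ k zero    = []
  staircase-≤ k (suc l) = All.++⁺ (All.replicate⁺ k ≤-refl) (staircase-≤1+ k l)

  staircase-≤1+ k l = All.map (λ x≤ → ≤-trans x≤ (*-monoˡ-≤ k (n≤1+n l))) (staircase-≤ k l)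

  staircase-decreasing : ∀ k l → Linked _≥_ (staircase k l)
  staircase-decreasing k zero    = []
  staircase-decreasing k (suc l) =
    replicate-++-decreasing k (staircase-≤1+ k l) (staircase-decreasing k l)

  suc*-positive : ∀ k .{{_ : NonZero k}} l → 0 < suc l * k
  suc*-positive k l = >-nonZero⁻¹ (suc l * k) {{m*n≢0 (suc l) k}}

  staircase-positive : ∀ k .{{_ : NonZero k}} l → All (0 <_) (staircase k l)
  staircase-positive k zero    = []
  staircase-positive k (suc l) =
    All.++⁺ (All.replicate⁺ k (suc*-positive k l)) (staircase-positive k l)

-- With l = m / k and r = m % k: r parts equal to (l + 1) * k, followed by
-- the staircase; r + l * k = m parts in total.
extremal : (m k : ℕ) .{{_ : NonZero k}} → Partition
extremal m k = mkPartition
  (replicate r (suc l * k) ++ staircase k l)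
  (replicate-++-decreasing r (staircase-≤1+ k l) (staircase-decreasing k l))
  (All.++⁺ (All.replicate⁺ r (suc*-positive k l)) (staircase-positive k l))
  where
  l = m / k
  r = m % k

t : (m k : ℕ) .{{_ : NonZero k}} → ℕ
t m k = weight (extremal m k)

{-# OPTIONS --safe #-}
module Submission where

-- Encode λ = (λ₁ ≥ … ≥ λₙ) by its set of beads λᵢ + n - i.  The beads sum to
-- |λ| + (0 + 1 + … + (n - 1)), and the k-hooks of λ are the positions i that
-- carry no bead although i + k does.  Moving all these beads from i + k to i at
-- once lowers the sum by k · α k λ, keeps the number of beads, and destroys at
-- most k of the k-hooks: every old k-hook becomes a position i with a bead and
-- without one at i + k, and within a residue class mod k such descents exceed
-- the k-hooks by at most one.  Iterating m / k + 1 times, and bounding a sum of n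
-- distinct naturals by 0 + 1 + … + (n - 1) at the end, gives the bound.

open import Defs
open import Data.Bool.Base using (Bool; true; false; if_then_else_; not; _∧_; _∨_)
open import Data.Bool.Properties using (∧-identityʳ; ∧-zeroʳ)
open import Data.List.Base using (List; []; _∷_; _++_; map; filter; length; replicate; applyUpTo; upTo)
open import Data.List.Properties using (filter-++; filter-≐; length-++; map-upTo)
open import Data.List.Relation.Unary.All as All using (All; []; _∷_)
open import Data.List.Relation.Unary.AllPairs using (AllPairs; []; _∷_)
open import Data.List.Relation.Unary.Linked.Properties using (Linked⇒AllPairs)
open import Data.Nat.Base hiding (compare)
open import Data.Nat.Properties
open import Data.Nat.DivMod using (m≡m%n+[m/n]*n)
open import Data.Nat.ListAction using (sum)
open import Data.Nat.Tactic.RingSolver using (solve-∀)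
open import Data.Nat.Combinatorics using (_C_; nC1≡n; nCk+nC[k+1]≡[n+1]C[k+1])
open import Data.Integer.Properties using (m-n≡m⊖n; ⊖-≥)
open import Data.Product.Base using (_×_; _,_; map₁; ∃-syntax)
open import Data.Sum.Base using (inj₁; inj₂)
open import Function.Base using (_∘_; id)
open import Function.Bundles using (mk⇔)
open import Relation.Binary.Definitions using (tri<; tri≈; tri>)
open import Relation.Binary.PropositionalEquality
open import Relation.Nullary.Decidable using (does; dec-true; dec-false; does-⇔; yes; no)
open import Relation.Unary using (Pred; Decidable)
open import Relation.Nullary.Negation using (contradiction)

-- Finite sums over initial segments of the naturals.

bit : Bool → ℕ
bit b = if b then 1 else 0

∑ : ℕ → (ℕ → ℕ) → ℕ
∑ zero    f = 0
∑ (suc n) f = f 0 + ∑ n (f ∘ suc)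

∑-cong< : ∀ n {f g : ℕ → ℕ} → (∀ i → i < n → f i ≡ g i) → ∑ n f ≡ ∑ n g
∑-cong< zero    f≡g = refl
∑-cong< (suc n) f≡g = cong₂ _+_ (f≡g 0 z<s) (∑-cong< n (λ i i<n → f≡g (suc i) (s<s i<n)))

∑-cong : ∀ n {f g : ℕ → ℕ} → (∀ i → f i ≡ g i) → ∑ n f ≡ ∑ n g
∑-cong n f≡g = ∑-cong< n (λ i _ → f≡g i)

∑-mono : ∀ n {f g : ℕ → ℕ} → (∀ i → f i ≤ g i) → ∑ n f ≤ ∑ n g
∑-mono zero    f≤g = z≤n
∑-mono (suc n) f≤g = +-mono-≤ (f≤g 0) (∑-mono n (f≤g ∘ suc))

∑-zero : ∀ n {f : ℕ → ℕ} → (∀ i → i < n → f i ≡ 0) → ∑ n f ≡ 0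
∑-zero zero    f≡0 = refl
∑-zero (suc n) f≡0 = cong₂ _+_ (f≡0 0 z<s) (∑-zero n (λ i i<n → f≡0 (suc i) (s<s i<n)))

∑-const : ∀ n a → ∑ n (λ _ → a) ≡ n * a
∑-const zero    a = refl
∑-const (suc n) a = cong (a +_) (∑-const n a)

∑-distrib-+ : ∀ n (f g : ℕ → ℕ) → ∑ n (λ i → f i + g i) ≡ ∑ n f + ∑ n g
∑-distrib-+ zero    f g = refl
∑-distrib-+ (suc n) f g = trans
  (cong (f 0 + g 0 +_) (∑-distrib-+ n (f ∘ suc) (g ∘ suc)))
  (interchange (f 0) (g 0) (∑ n (f ∘ suc)) (∑ n (g ∘ suc)))
  where
  interchange : ∀ a b c d → a + b + (c + d) ≡ a + c + (b + d)
  interchange = solve-∀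

∑-split : ∀ m n (f : ℕ → ℕ) → ∑ (m + n) f ≡ ∑ m f + ∑ n (λ i → f (m + i))
∑-split zero    n f = refl
∑-split (suc m) n f = trans (cong (f 0 +_) (∑-split m n (f ∘ suc))) (sym (+-assoc (f 0) _ _))

∑-distribʳ-* : ∀ n (f : ℕ → ℕ) a → ∑ n (λ i → f i * a) ≡ ∑ n f * a
∑-distribʳ-* zero    f a = refl
∑-distribʳ-* (suc n) f a =
  trans (cong (f 0 * a +_) (∑-distribʳ-* n (f ∘ suc) a)) (sym (*-distribʳ-+ a (f 0) _))

∑-single : ∀ {n j} {f : ℕ → ℕ} → j < n → (∀ i → i ≢ j → f i ≡ 0) → ∑ n f ≡ f j
∑-single {suc n} {zero}  {f} _   f≡0 =
  trans (cong (f 0 +_) (∑-zero n (λ i _ → f≡0 (suc i) λ ()))) (+-identityʳ (f 0))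
∑-single {suc n} {suc j} {f} j<n f≡0 =
  cong₂ _+_ (f≡0 0 λ ()) (∑-single (s<s⁻¹ j<n) (λ i i≢j → f≡0 (suc i) (i≢j ∘ suc-injective)))

∑-extend : ∀ m n {f : ℕ → ℕ} → (∀ i → m ≤ i → f i ≡ 0) → ∑ (n + m) f ≡ ∑ m f
∑-extend m n {f} f≡0 = begin
  ∑ (n + m) f                      ≡⟨ cong (λ s → ∑ s f) (+-comm n m) ⟩
  ∑ (m + n) f                      ≡⟨ ∑-split m n f ⟩
  ∑ m f + ∑ n (λ i → f (m + i))    ≡⟨ cong (∑ m f +_) (∑-zero n (λ i _ → f≡0 (m + i) (m≤m+n m i))) ⟩
  ∑ m f + 0                        ≡⟨ +-identityʳ _ ⟩
  ∑ m f                            ∎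
  where open ≡-Reasoning

-- Only the first `k` terms leave the window when it slides up by `k`, and each is at most 1. This
-- is the source of the loss of at most `k` hooks per move.
∑-shift-≤ : ∀ k n {f : ℕ → ℕ} → (∀ i → f i ≤ 1) → ∑ n f ≤ k + ∑ n (λ i → f (k + i))
∑-shift-≤ zero    n f≤1 = ≤-refl
∑-shift-≤ (suc k) n {f} f≤1 = begin
  ∑ n f                                ≤⟨ shift₁ n f ⟩
  f 0 + ∑ n (f ∘ suc)                  ≤⟨ +-mono-≤ (f≤1 0) (∑-shift-≤ k n (f≤1 ∘ suc)) ⟩
  suc k + ∑ n (λ i → f (suc k + i))    ∎
  where
  open ≤-Reasoning
  shift₁ : ∀ n f → ∑ n f ≤ ∑ (suc n) f
  shift₁ zero    f = z≤n
  shift₁ (suc n) f = +-monoʳ-≤ (f 0) (shift₁ n (f ∘ suc))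

∑-suc : ∀ n → ∑ n suc ≡ n + ∑ n id
∑-suc n = trans (∑-distrib-+ n (λ _ → 1) id)
                (cong (_+ ∑ n id) (trans (∑-const n 1) (*-identityʳ n)))

bit≤1 : ∀ b → bit b ≤ 1
bit≤1 true  = ≤-refl
bit≤1 false = z≤n

-- Distinct naturals sum to at least 0 + 1 + ... + (n - 1). Dropping position 0 and shifting the
-- rest down lowers each remaining element by one, which matches `∑-suc` on the other side.
∑-id-≤ : ∀ M (b : ℕ → Bool) →
         ∑ (∑ M (bit ∘ b)) id ≤ ∑ M (λ i → bit (b i) * i)
∑-id-≤ zero    b = z≤n
∑-id-≤ (suc M) b = begin
  ∑ (bit (b 0) + n) id                        ≤⟨ step (b 0) ⟩
  n + ∑ n id                                  ≤⟨ +-monoʳ-≤ n (∑-id-≤ M (b ∘ suc)) ⟩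
  n + ∑ M (λ i → bit (b (suc i)) * i)         ≡⟨ ∑-distrib-+ M (bit ∘ b ∘ suc) _ ⟨
  ∑ M (λ i → bit (b (suc i)) + bit (b (suc i)) * i)
                                              ≡⟨ ∑-cong M (λ i → sym (*-suc (bit (b (suc i))) i)) ⟩
  ∑ M (λ i → bit (b (suc i)) * suc i)
    ≡⟨ cong (_+ ∑ M (λ i → bit (b (suc i)) * suc i)) (*-zeroʳ (bit (b 0))) ⟨
  bit (b 0) * 0 + ∑ M (λ i → bit (b (suc i)) * suc i) ∎
  where
  open ≤-Reasoning
  n = ∑ M (bit ∘ b ∘ suc)
  step : ∀ c → ∑ (bit c + n) id ≤ n + ∑ n id
  step false = m≤n+m _ n
  step true  = ≤-reflexive (∑-suc n)

-- Bead sets and the simultaneous move of all hooks.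

-- Translates the set `h` up by `k`. Truncated subtraction `h (i ∸ k)` would wrongly send every
-- position below `k` to 0; here those positions are empty.
delay : ℕ → (ℕ → Bool) → ℕ → Bool
delay zero    h i       = h i
delay (suc k) h zero    = false
delay (suc k) h (suc i) = delay k h i

delay-+ : ∀ k h i → delay k h (k + i) ≡ h i
delay-+ zero    h i = refl
delay-+ (suc k) h i = delay-+ k h i

delay-true : ∀ k h i → delay k h i ≡ true → ∃[ j ] i ≡ k + j × h j ≡ true
delay-true zero    h i       eq = i , refl , eq
delay-true (suc k) h (suc i) eq with j , i≡ , hj ← delay-true k h i eq = j , cong suc i≡ , hj

∑-delay : ∀ k n h (f : ℕ → ℕ) →
          ∑ (k + n) (λ i → bit (delay k h i) * f i) ≡ ∑ n (λ j → bit (h j) * f (k + j))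
∑-delay zero    n h f = refl
∑-delay (suc k) n h f = ∑-delay k n h (f ∘ suc)

-- b is the characteristic function of a set of beads; a hook is recorded at
-- its lower end i.
hook : ℕ → (ℕ → Bool) → ℕ → Bool
hook k b i = not (b i) ∧ b (k + i)

hookCount : ℕ → ℕ → (ℕ → Bool) → ℕ
hookCount k M b = ∑ M (bit ∘ hook k b)

-- A bead is at `i` after the move if one arrives from `k + i`, or if one was there and does not
-- leave. Both conditions refer to the old set `b`, so all moves happen at once.
moveDown : ℕ → (ℕ → Bool) → ℕ → Bool
moveDown k b i = hook k b i ∨ (b i ∧ not (delay k (hook k b) i))

Bounded : ℕ → (ℕ → Bool) → Set
Bounded M b = ∀ i → M ≤ i → b i ≡ false

module _ (k : ℕ) (b : ℕ → Bool) where
  private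
    h = hook k b
    b′ = moveDown k b

  delay-hook-bead : ∀ i → delay k h i ≡ true → b i ≡ true
  delay-hook-bead i d with delay-true k h i d
  ... | j , refl , hj with b j | b (k + j)
  ... | false | true = refl

  -- An arrival at `i` needs a gap there and a departure needs a bead, so the two never coincide and
  -- the truth values add up as numbers.
  moveDown-bit : ∀ i → bit (b′ i) + bit (delay k h i) ≡ bit (b i) + bit (h i)
  moveDown-bit i with b i | b (k + i) | delay k h i | delay-hook-bead i
  ... | true  | _     | true  | _  = refl
  ... | true  | _     | false | _  = refl
  ... | false | true  | false | _  = refl
  ... | false | false | false | _  = refl
  ... | false | true  | true  | eq = contradiction (eq refl) λ ()
  ... | false | false | true  | eq = contradiction (eq refl) λ ()

  -- The bead of the hook fills `i` and leaves `k + i`. Nothing refills `k + i`, since beads arrive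
  -- only at positions that were gaps.
  moveDown-descent : ∀ i → bit (h i) ≤ bit (b′ i ∧ not (b′ (k + i)))
  moveDown-descent i rewrite delay-+ k h i with b i | b (k + i)
  ... | true  | _     = z≤n
  ... | false | false = z≤n
  ... | false | true  = ≤-refl

  module _ {M : ℕ} (bounded : Bounded M b) where

    hook-bounded : Bounded M h
    hook-bounded i M≤i rewrite bounded (k + i) (≤-trans M≤i (m≤n+m i k)) = ∧-zeroʳ (not (b i))

    moveDown-bounded : Bounded M b′
    moveDown-bounded i M≤i rewrite hook-bounded i M≤i | bounded i M≤i = refl

    -- Kept general in the weight `f`: constant 1 gives the conservation of beads, the identity
    -- gives the drop of the bead sum.
    moveDown-∑ : ∀ (f : ℕ → ℕ) →
      ∑ M (λ i → bit (b′ i) * f i) + ∑ M (λ i → bit (h i) * f (k + i)) ≡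
      ∑ M (λ i → bit (b i) * f i) + ∑ M (λ i → bit (h i) * f i)
    moveDown-∑ f = begin
      ∑ M (λ i → bit (b′ i) * f i) + ∑ M (λ i → bit (h i) * f (k + i))
        ≡⟨ cong₂ _+_ (extend moveDown-bounded) (∑-delay k M h f) ⟨
      ∑ K (λ i → bit (b′ i) * f i) + ∑ K (λ i → bit (delay k h i) * f i)
        ≡⟨ ∑-distrib-+ K _ _ ⟨
      ∑ K (λ i → bit (b′ i) * f i + bit (delay k h i) * f i)
        ≡⟨ ∑-cong K pointwise ⟩
      ∑ K (λ i → bit (b i) * f i + bit (h i) * f i)
        ≡⟨ ∑-distrib-+ K _ _ ⟩
      ∑ K (λ i → bit (b i) * f i) + ∑ K (λ i → bit (h i) * f i)
        ≡⟨ cong₂ _+_ (extend bounded) (extend hook-bounded) ⟩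
      ∑ M (λ i → bit (b i) * f i) + ∑ M (λ i → bit (h i) * f i) ∎
      where
      open ≡-Reasoning
      -- Departures happen at `k + i` with `i < M`, so the window has to reach `k + M`; the other
      -- summands vanish on the added positions.
      K = k + M
      extend : ∀ {c} → Bounded M c →
               ∑ K (λ i → bit (c i) * f i) ≡ ∑ M (λ i → bit (c i) * f i)
      extend c-bounded = ∑-extend M k (λ i M≤i → cong (λ x → bit x * f i) (c-bounded i M≤i))
      pointwise : ∀ i → bit (b′ i) * f i + bit (delay k h i) * f i ≡ bit (b i) * f i + bit (h i) * f i
      pointwise i = begin
        bit (b′ i) * f i + bit (delay k h i) * f i    ≡⟨ *-distribʳ-+ (f i) (bit (b′ i)) _ ⟨
        (bit (b′ i) + bit (delay k h i)) * f i        ≡⟨ cong (_* f i) (moveDown-bit i) ⟩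
        (bit (b i) + bit (h i)) * f i                 ≡⟨ *-distribʳ-+ (f i) (bit (b i)) _ ⟩
        bit (b i) * f i + bit (h i) * f i             ∎

    moveDown-count : ∑ M (bit ∘ b′) ≡ ∑ M (bit ∘ b)
    moveDown-count = +-cancelʳ-≡ (∑ M (bit ∘ h)) _ _ (begin
      ∑ M (bit ∘ b′) + ∑ M (bit ∘ h)                          ≡⟨ cong₂ _+_ (units b′) (units h) ⟩
      ∑ M (λ i → bit (b′ i) * 1) + ∑ M (λ i → bit (h i) * 1)  ≡⟨ moveDown-∑ (λ _ → 1) ⟩
      ∑ M (λ i → bit (b i) * 1) + ∑ M (λ i → bit (h i) * 1)   ≡⟨ cong₂ _+_ (units b) (units h) ⟨
      ∑ M (bit ∘ b) + ∑ M (bit ∘ h)                           ∎)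
      where
      open ≡-Reasoning
      units : ∀ c → ∑ M (bit ∘ c) ≡ ∑ M (λ i → bit (c i) * 1)
      units c = ∑-cong M (λ i → sym (*-identityʳ (bit (c i))))

    moveDown-sum : ∑ M (λ i → bit (b′ i) * i) + hookCount k M b * k ≡ ∑ M (λ i → bit (b i) * i)
    moveDown-sum = +-cancelʳ-≡ H _ _ (begin
      B′ + hookCount k M b * k + H
        ≡⟨ +-assoc B′ _ H ⟩
      B′ + (hookCount k M b * k + H)
        ≡⟨ cong (λ x → B′ + (x + H)) (∑-distribʳ-* M (bit ∘ h) k) ⟨
      B′ + (∑ M (λ i → bit (h i) * k) + H)
        ≡⟨ cong (B′ +_) (∑-distrib-+ M _ _) ⟨
      B′ + ∑ M (λ i → bit (h i) * k + bit (h i) * i)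
        ≡⟨ cong (B′ +_) (∑-cong M (λ i → sym (*-distribˡ-+ (bit (h i)) k i))) ⟩
      B′ + ∑ M (λ i → bit (h i) * (k + i))
        ≡⟨ moveDown-∑ id ⟩
      ∑ M (λ i → bit (b i) * i) + H ∎)
      where
      open ≡-Reasoning
      B′ = ∑ M (λ i → bit (b′ i) * i)
      H  = ∑ M (λ i → bit (h i) * i)

  -- Each old hook is a descent of `b′`: a bead at `i` and none at `k + i`. The excess of descents
  -- over hooks of `b′` telescopes to the difference of two windows of `b′` shifted by `k`.
  moveDown-hookCount : ∀ M → hookCount k M b ≤ hookCount k M b′ + k
  moveDown-hookCount M = ≤-trans (∑-mono M moveDown-descent) (+-cancelʳ-≤ B (∑ M d) _ (begin
    ∑ M d + B                              ≡⟨ ∑-distrib-+ M _ _ ⟨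
    ∑ M (λ i → d i + bit (b′ (k + i)))     ≡⟨ ∑-cong M (λ i → balance (b′ i) (b′ (k + i))) ⟩
    ∑ M (λ i → bit (hook k b′ i) + bit (b′ i)) ≡⟨ ∑-distrib-+ M _ _ ⟩
    hookCount k M b′ + ∑ M (bit ∘ b′)      ≤⟨ +-monoʳ-≤ (hookCount k M b′) (∑-shift-≤ k M (bit≤1 ∘ b′)) ⟩
    hookCount k M b′ + (k + B)             ≡⟨ +-assoc (hookCount k M b′) k B ⟨
    hookCount k M b′ + k + B               ∎))
    where
    open ≤-Reasoning
    d : ℕ → ℕ
    d i = bit (b′ i ∧ not (b′ (k + i)))
    B = ∑ M (λ i → bit (b′ (k + i)))
    -- Both sides equal `bit (x ∨ y)`.
    balance : ∀ x y → bit (x ∧ not y) + bit y ≡ bit (not x ∧ y) + bit x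
    balance true  true  = refl
    balance true  false = refl
    balance false true  = refl
    balance false false = refl

-- Iterating the move.

sum-replicate-++ : ∀ n x ys → sum (replicate n x ++ ys) ≡ n * x + sum ys
sum-replicate-++ zero    x ys = refl
sum-replicate-++ (suc n) x ys =
  trans (cong (x +_) (sum-replicate-++ n x ys)) (sym (+-assoc x (n * x) _))

-- For j = l, l - 1, ..., 0 there are at least r + jk hooks before the move, so it lowers the bead
-- sum by at least (r + jk)k, and for j > 0 it leaves at least r + (j - 1)k hooks. These drops add
-- up to the weight on the left; `∑-id-≤` bounds the beads left at the end.
beads-≥ : ∀ k r l {M} b → Bounded M b → r + l * k ≤ hookCount k M b →
          ∑ (∑ M (bit ∘ b)) id + (r * (suc l * k) + sum (staircase k l)) ≤ ∑ M (λ i → bit (b i) * i)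
beads-≥ k r l {M} b bounded hooks = begin
  ∑ (∑ M (bit ∘ b)) id + (r * (suc l * k) + sum (staircase k l))
    ≡⟨ cong (λ n → ∑ n id + _) (moveDown-count k b bounded) ⟨
  ∑ n′ id + (r * (suc l * k) + sum (staircase k l))
    ≤⟨ step l hooks ⟩
  B′ + hookCount k M b * k
    ≡⟨ moveDown-sum k b bounded ⟩
  ∑ M (λ i → bit (b i) * i) ∎
  where
  open ≤-Reasoning
  b′ = moveDown k b
  n′ = ∑ M (bit ∘ b′)
  B′ = ∑ M (λ i → bit (b′ i) * i)
  step : ∀ l → r + l * k ≤ hookCount k M b →
         ∑ n′ id + (r * (suc l * k) + sum (staircase k l)) ≤ B′ + hookCount k M b * k
  step zero hooks = +-mono-≤ (∑-id-≤ M b′) (begin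
    r * (1 * k) + 0       ≡⟨ solve r k ⟩
    (r + 0 * k) * k       ≤⟨ *-monoˡ-≤ k hooks ⟩
    hookCount k M b * k   ∎)
    where
    solve : ∀ r k → r * (1 * k) + 0 ≡ (r + 0 * k) * k
    solve = solve-∀
  step (suc l) hooks = begin
    ∑ n′ id + (r * (suc (suc l) * k) + sum (staircase k (suc l)))
      ≡⟨ cong (λ s → ∑ n′ id + (r * (suc (suc l) * k) + s))
              (sum-replicate-++ k (suc l * k) (staircase k l)) ⟩
    ∑ n′ id + (r * (suc (suc l) * k) + (k * (suc l * k) + sum (staircase k l)))
      -- Going from `l` to `suc l` adds `k` to each of the `r` top parts and inserts `k` parts
      -- `suc l * k`: exactly the drop paid for by one move.
      ≡⟨ rearrange (∑ n′ id) r l k (sum (staircase k l)) ⟩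
    ∑ n′ id + (r * (suc l * k) + sum (staircase k l)) + (r + suc l * k) * k
      ≤⟨ +-mono-≤ (beads-≥ k r l b′ (moveDown-bounded k b bounded) hooks′) (*-monoˡ-≤ k hooks) ⟩
    B′ + hookCount k M b * k ∎
    where
    rearrange : ∀ n r l k s → n + (r * (suc (suc l) * k) + (k * (suc l * k) + s)) ≡
                              n + (r * (suc l * k) + s) + (r + suc l * k) * k
    rearrange = solve-∀
    solve : ∀ r l k → r + l * k + k ≡ r + suc l * k
    solve = solve-∀
    hooks′ : r + l * k ≤ hookCount k M b′
    hooks′ = +-cancelʳ-≤ k _ _ (begin
      r + l * k + k          ≡⟨ solve r l k ⟩
      r + suc l * k          ≤⟨ hooks ⟩
      hookCount k M b        ≤⟨ moveDown-hookCount k b M ⟩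
      hookCount k M b′ + k   ∎)

-- The bead set of a partition.

beads : List ℕ → ℕ → Bool
beads []       x = false
beads (p ∷ ps) x = does (x ≟ p + length ps) ∨ beads ps x

-- Beads strictly decrease along the parts, even for equal parts, because the number of parts that
-- follow drops by one.
drop-head-< : ∀ {p q n x} → q ≤ p → p + suc n ≤ x → q + n < x
drop-head-< {p} {q} {n} q≤p p+n<x =
  ≤-trans (≤-trans (≤-reflexive (sym (+-suc q n))) (+-monoˡ-≤ (suc n) q≤p)) p+n<x

-- Here `p` is any upper bound of the parts: the part in front of `ps` in the inductions, and
-- finally the sum of all parts.
beads-bounded : ∀ {p ps} → All (_≤ p) ps → AllPairs _≥_ ps → Bounded (p + length ps) (beads ps)
beads-bounded []                       []           x _   = refl
beads-bounded {p} {q ∷ qs} (q≤p ∷ _) (qs≤q ∷ qs↘) x p≤x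
  rewrite dec-false (x ≟ q + length qs) (>⇒≢ (drop-head-< q≤p p≤x)) =
  beads-bounded qs≤q qs↘ x (<⇒≤ (drop-head-< q≤p p≤x))

module _ {p : ℕ} {ps : List ℕ} (ps≤p : All (_≤ p) ps) (ps↘ : AllPairs _≥_ ps) where
  private
    N = p + length ps
    b = beads ps

  -- The new bead `N` lies above all beads of `ps`, so the disjunction is disjoint and becomes a
  -- sum.
  beads-∷-bit : ∀ x → bit (beads (p ∷ ps) x) ≡ bit (does (x ≟ N)) + bit (b x)
  beads-∷-bit x with x ≟ N
  ... | yes refl rewrite dec-true (N ≟ N) refl | beads-bounded ps≤p ps↘ N ≤-refl = refl
  ... | no x≢N   rewrite dec-false (x ≟ N) x≢N = refl

  beads-∷-∑ : ∀ {M} → N < M → ∀ (f : ℕ → ℕ) →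
    ∑ M (λ i → bit (beads (p ∷ ps) i) * f i) ≡ f N + ∑ M (λ i → bit (b i) * f i)
  beads-∷-∑ {M} N<M f = begin
    ∑ M (λ i → bit (beads (p ∷ ps) i) * f i)
      ≡⟨ ∑-cong M (λ i → trans (cong (_* f i) (beads-∷-bit i))
                               (*-distribʳ-+ (f i) (bit (does (i ≟ N))) _)) ⟩
    ∑ M (λ i → bit (does (i ≟ N)) * f i + bit (b i) * f i)
      ≡⟨ ∑-distrib-+ M _ _ ⟩
    ∑ M (λ i → bit (does (i ≟ N)) * f i) + ∑ M (λ i → bit (b i) * f i)
      ≡⟨ cong (_+ ∑ M (λ i → bit (b i) * f i))
              (∑-single N<M (λ i i≢N → cong (λ x → bit x * f i) (dec-false (i ≟ N) i≢N))) ⟩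
    bit (does (N ≟ N)) * f N + ∑ M (λ i → bit (b i) * f i)
      ≡⟨ cong (λ x → bit x * f N + ∑ M (λ i → bit (b i) * f i)) (dec-true (N ≟ N) refl) ⟩
    1 * f N + ∑ M (λ i → bit (b i) * f i)
      ≡⟨ cong (_+ ∑ M (λ i → bit (b i) * f i)) (*-identityˡ (f N)) ⟩
    f N + ∑ M (λ i → bit (b i) * f i) ∎
    where open ≡-Reasoning

  -- The new bead `N` can only be the upper end of a hook: above it there are no beads. It destroys
  -- no hook either, since a hook at `N` would need a bead at `k + N`.
  beads-∷-hook : ∀ {k} → 0 < k → ∀ i →
    bit (hook k (beads (p ∷ ps)) i) ≡ bit (not (b i) ∧ does (k + i ≟ N)) + bit (hook k b i)
  beads-∷-hook {k} 0<k i with i ≟ N | k + i ≟ N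
  ... | yes refl | yes k+N≡N = contradiction (sym k+N≡N) (<⇒≢ (m<n+m N 0<k))
  ... | yes refl | no  k+N≢N
        rewrite dec-true (N ≟ N) refl | dec-false (k + N ≟ N) k+N≢N
              | beads-bounded ps≤p ps↘ N ≤-refl | beads-bounded ps≤p ps↘ (k + N) (m≤n+m N k) = refl
  ... | no i≢N   | no  k+i≢N
        rewrite dec-false (i ≟ N) i≢N | dec-false (k + i ≟ N) k+i≢N | ∧-zeroʳ (not (b i)) = refl
  ... | no i≢N   | yes k+i≡N
        rewrite dec-false (i ≟ N) i≢N | dec-true (k + i ≟ N) k+i≡N
              | beads-bounded ps≤p ps↘ (k + i) (≤-reflexive (sym k+i≡N)) with b i
  ...     | true  = refl
  ...     | false = refl

-- Columns of the diagram and gaps between beads.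

colLength : List ℕ → ℕ → ℕ
colLength []       c = 0
colLength (q ∷ qs) c = bit (does (c <? q)) + colLength qs c

colLength-zero : ∀ {q qs c} → All (_≤ q) qs → q ≤ c → colLength qs c ≡ 0
colLength-zero []                         q≤c = refl
colLength-zero {c = c} (_∷_ {x} x≤q qs≤q) q≤c
  rewrite dec-false (c <? x) (≤⇒≯ (≤-trans x≤q q≤c)) = colLength-zero qs≤q q≤c

colLength-≤ : ∀ qs c → colLength qs c ≤ length qs
colLength-≤ []       c = z≤n
colLength-≤ (q ∷ qs) c = +-mono-≤ (bit≤1 (does (c <? q))) (colLength-≤ qs c)

-- c ↦ c + length ps - colLength ps c enumerates the gaps of beads ps.
gap-unique : ∀ {p ps x} → All (_≤ p) ps → AllPairs _≥_ ps → x < p + length ps →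
  ∑ p (λ c → bit (does (c + length ps ≟ x + colLength ps c))) + bit (beads ps x) ≡ 1
gap-unique {p} {[]} {x} [] [] x<p = begin
  ∑ p (λ c → bit (does (c + 0 ≟ x + 0))) + 0  ≡⟨ +-identityʳ _ ⟩
  ∑ p (λ c → bit (does (c + 0 ≟ x + 0)))
    ≡⟨ ∑-single (subst (x <_) (+-identityʳ p) x<p)
         (λ c c≢x → cong bit (dec-false (c + 0 ≟ x + 0) (c≢x ∘ +-cancelʳ-≡ 0 c x))) ⟩
  bit (does (x + 0 ≟ x + 0))                  ≡⟨ cong bit (dec-true (x + 0 ≟ x + 0) refl) ⟩
  1                                           ∎
  where open ≡-Reasoning
gap-unique {p} {q ∷ qs} {x} (q≤p ∷ _) (qs≤q ∷ qs↘) x<p+n with m≤n⇒∃[o]m+o≡n q≤p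
-- Split the columns at `q`. In columns below `q` the first row raises both the column length and
-- the number of rows by one, which cancels; the remaining `e` columns are empty and give the gaps
-- just above the bead `q + n`.
... | e , refl = begin
  ∑ (q + e) F + bit (beads (q ∷ qs) x)
    ≡⟨ cong (_+ bit (beads (q ∷ qs) x)) (∑-split q e F) ⟩
  ∑ q F + ∑ e (λ c → F (q + c)) + bit (beads (q ∷ qs) x)
    ≡⟨ cong₂ (λ s t → s + t + bit (beads (q ∷ qs) x)) (∑-cong< q inside) (∑-cong e outside) ⟩
  ∑ q G + ∑ e (λ c → bit (does (q + c + suc n ≟ x))) + bit (beads (q ∷ qs) x)
    ≡⟨ compare ⟩
  1 ∎
  where
  open ≡-Reasoning
  n = length qs
  F G : ℕ → ℕ
  F c = bit (does (c + suc n ≟ x + colLength (q ∷ qs) c))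
  G c = bit (does (c + n ≟ x + colLength qs c))
  inside : ∀ c → c < q → F c ≡ G c
  inside c c<q rewrite dec-true (c <? q) c<q | +-suc c n | +-suc x (colLength qs c) = refl
  outside : ∀ c → F (q + c) ≡ bit (does (q + c + suc n ≟ x))
  outside c rewrite dec-false (q + c <? q) (≤⇒≯ (m≤m+n q c))
                  | colLength-zero qs≤q (m≤m+n q c) | +-identityʳ x = refl
  inside-zero : q + n ≤ x → ∑ q G ≡ 0
  inside-zero q+n≤x = ∑-zero q (λ c c<q → cong bit (dec-false (c + n ≟ x + colLength qs c)
    (<⇒≢ (≤-trans (+-monoˡ-< n c<q) (≤-trans q+n≤x (m≤m+n x _))))))
  outside-zero : x ≤ q + n → ∑ e (λ c → bit (does (q + c + suc n ≟ x))) ≡ 0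
  outside-zero x≤q+n = ∑-zero e (λ c _ → cong bit (dec-false (q + c + suc n ≟ x)
    (>⇒≢ (≤-<-trans x≤q+n (+-mono-≤-< (m≤m+n q c) (n<1+n n))))))
  compare : ∑ q G + ∑ e (λ c → bit (does (q + c + suc n ≟ x))) + bit (beads (q ∷ qs) x) ≡ 1
  -- Below the bead of `q` induction applies; at it only the bead counts; above it `x` is the gap of
  -- the single column `q + y`.
  compare with <-cmp x (q + n)
  ... | tri< x<q+n _ _
        rewrite outside-zero (<⇒≤ x<q+n) | +-identityʳ (∑ q G) | dec-false (x ≟ q + n) (<⇒≢ x<q+n)
        = gap-unique qs≤q qs↘ x<q+n
  ... | tri≈ _ x≡q+n _
        rewrite outside-zero (≤-reflexive x≡q+n) | inside-zero (≤-reflexive (sym x≡q+n))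
              | dec-true (x ≟ q + n) x≡q+n = refl
  ... | tri> _ _ q+n<x
        rewrite inside-zero (<⇒≤ q+n<x) | dec-false (x ≟ q + n) (>⇒≢ q+n<x)
              | beads-bounded qs≤q qs↘ x (<⇒≤ q+n<x)
        with m≤n⇒∃[o]m+o≡n q+n<x
  ...     | y , refl = trans (+-identityʳ _) (trans
              (∑-single y<e (λ c c≢y → cong bit (dec-false (q + c + suc n ≟ x)
                (λ eq → c≢y (+-cancelˡ-≡ (suc (q + n)) c y (trans (shuffle q n c) eq))))))
              (cong bit (dec-true (q + y + suc n ≟ x) (sym (shuffle q n y)))))
    where
    shuffle : ∀ q n c → suc (q + n) + c ≡ q + c + suc n
    shuffle = solve-∀
    y<e : y < e
    y<e = +-cancelˡ-< (suc (q + n)) y e (subst (suc (q + n) + y <_) (sym (shuffle q n e)) x<p+n)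

-- Counting cells row by row and hook lengths.

module _ {ℓ} {P : Pred Cell ℓ} (P? : Decidable P) where

  count-∷ : ∀ p ps → length (filter P? (diagram (p ∷ ps))) ≡
    ∑ p (λ c → bit (does (P? (0 , c)))) + length (filter (P? ∘ map₁ suc) (diagram ps))
  count-∷ p ps = begin
    length (filter P? (map (0 ,_) (upTo p) ++ map (map₁ suc) (diagram ps)))
      ≡⟨ cong length (filter-++ P? (map (0 ,_) (upTo p)) _) ⟩
    length (filter P? (map (0 ,_) (upTo p)) ++ filter P? (map (map₁ suc) (diagram ps)))
      ≡⟨ length-++ (filter P? (map (0 ,_) (upTo p))) ⟩
    length (filter P? (map (0 ,_) (upTo p))) + length (filter P? (map (map₁ suc) (diagram ps)))
      ≡⟨ cong₂ _+_ (trans (cong (length ∘ filter P?) (map-upTo (0 ,_) p)) (row-count p (0 ,_)))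
                   (rest-count (diagram ps)) ⟩
    ∑ p (λ c → bit (does (P? (0 , c)))) + length (filter (P? ∘ map₁ suc) (diagram ps)) ∎
    where
    open ≡-Reasoning
    row-count : ∀ n (f : ℕ → Cell) →
                length (filter P? (applyUpTo f n)) ≡ ∑ n (λ c → bit (does (P? (f c))))
    row-count zero    f = refl
    row-count (suc n) f with does (P? (f 0))
    ... | true  = cong suc (row-count n (f ∘ suc))
    ... | false = row-count n (f ∘ suc)
    rest-count : ∀ us → length (filter P? (map (map₁ suc) us)) ≡ length (filter (P? ∘ map₁ suc) us)
    rest-count []       = refl
    rest-count (u ∷ us) with does (P? (map₁ suc u))
    ... | true  = cong suc (rest-count us)
    ... | false = rest-count us

column-count : ∀ ps c → length (filter (λ u → col u ≟ c) (diagram ps)) ≡ colLength ps c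
column-count []       c = refl
column-count (p ∷ ps) c = trans (count-∷ (λ u → col u ≟ c) p ps) (cong₂ _+_ row-part (column-count ps c))
  where
  row-part : ∑ p (λ d → bit (does (d ≟ c))) ≡ bit (does (c <? p))
  row-part with c <? p
  ... | yes c<p = trans (∑-single c<p (λ d d≢c → cong bit (dec-false (d ≟ c) d≢c)))
                        (cong bit (trans (dec-true (c ≟ c) refl) (sym (dec-true (c <? p) c<p))))
  ... | no  c≮p = trans (∑-zero p (λ d d<p → cong bit (dec-false (d ≟ c) (λ { refl → c≮p d<p }))))
                        (sym (cong bit (dec-false (c <? p) c≮p)))

-- Taken on bare lists so that induction can pass to the tail; on the parts of a partition it
-- unfolds to the same term as `hookLength`.
hookLen : List ℕ → Cell → ℕ
hookLen ps u = length (filter (inHook? u) (diagram ps))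

-- The hook meets row 0 in columns `c` to `p - 1`, corner included, and the lower rows in their
-- column `c`.
hookLen-first-row : ∀ p ps c → hookLen (p ∷ ps) (0 , c) ≡ p ∸ c + colLength ps c
hookLen-first-row p ps c = trans (count-∷ (inHook? (0 , c)) p ps) (cong₂ _+_ arm leg)
  where
  arm-count : ∀ p c → ∑ p (λ d → bit (does (c ≤? d))) ≡ p ∸ c
  arm-count zero    zero    = refl
  arm-count zero    (suc c) = refl
  arm-count (suc p) zero    = cong suc (arm-count p 0)
  arm-count (suc p) (suc c) = trans
    (∑-cong p (λ d → cong bit (does-⇔ (mk⇔ s≤s⁻¹ s≤s) (suc c ≤? suc d) (c ≤? d))))
    (arm-count p c)
  arm : ∑ p (λ d → bit (does (inHook? (0 , c) (0 , d)))) ≡ p ∸ c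
  arm = trans
    (∑-cong p (λ d → cong bit (does-⇔ (mk⇔ to from) (inHook? (0 , c) (0 , d)) (c ≤? d))))
    (arm-count p c)
    where
    to : ∀ {d} → InHook (0 , c) (0 , d) → c ≤ d
    to (inj₁ refl)                = ≤-refl
    to (inj₂ (inj₂ (_ , c<d)))    = <⇒≤ c<d
    from : ∀ {d} → c ≤ d → InHook (0 , c) (0 , d)
    from c≤d with m≤n⇒m<n∨m≡n c≤d
    ... | inj₁ c<d  = inj₂ (inj₂ (refl , c<d))
    ... | inj₂ refl = inj₁ refl
  leg : length (filter (inHook? (0 , c) ∘ map₁ suc) (diagram ps)) ≡ colLength ps c
  leg = trans (cong length (filter-≐ (inHook? (0 , c) ∘ map₁ suc) (λ u → col u ≟ c)
                ((λ { (inj₂ (inj₁ (_ , eq))) → eq }) , λ eq → inj₂ (inj₁ (z<s , eq))) (diagram ps)))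
              (column-count ps c)

hookLen-suc-row : ∀ p ps u → hookLen (p ∷ ps) (map₁ suc u) ≡ hookLen ps u
hookLen-suc-row p ps u = trans (count-∷ (inHook? (map₁ suc u)) p ps) (cong₂ _+_
  (∑-zero p (λ d _ → cong bit (dec-false (inHook? (map₁ suc u) (0 , d))
    λ { (inj₂ (inj₁ (() , _))) ; (inj₂ (inj₂ (() , _))) })))
  (cong length (filter-≐ (inHook? (map₁ suc u) ∘ map₁ suc) (inHook? u) (to , from) (diagram ps))))
  where
  to : ∀ {v} → InHook (map₁ suc u) (map₁ suc v) → InHook u v
  to (inj₁ refl)                    = inj₁ refl
  to (inj₂ (inj₁ (r , c)))          = inj₂ (inj₁ (s<s⁻¹ r , c))
  to (inj₂ (inj₂ (r , c)))          = inj₂ (inj₂ (suc-injective r , c))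
  from : ∀ {v} → InHook u v → InHook (map₁ suc u) (map₁ suc v)
  from (inj₁ refl)                  = inj₁ refl
  from (inj₂ (inj₁ (r , c)))        = inj₂ (inj₁ (s<s r , c))
  from (inj₂ (inj₂ (r , c)))        = inj₂ (inj₂ (cong suc r , c))

-- Hooks of the diagram as hooks of the bead set.

countHooks : ℕ → List ℕ → ℕ
countHooks k ps = length (filter (λ u → hookLen ps u ≟ k) (diagram ps))

-- The cell in column `c` has hook length `k` exactly when `N - k` is the gap belonging to column
-- `c`. By `gap-unique` there is one such column if `N - k` carries no bead, and none otherwise.
first-row-hooks : ∀ {k p ps M} → 0 < k → All (_≤ p) ps → AllPairs _≥_ ps → p + length ps < M →
  ∑ p (λ c → bit (does (hookLen (p ∷ ps) (0 , c) ≟ k))) ≡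
  ∑ M (λ i → bit (not (beads ps i) ∧ does (k + i ≟ p + length ps)))
first-row-hooks {k} {p} {ps} {M} 0<k ps≤p ps↘ N<M =
  trans (∑-cong p (λ c → cong (λ h → bit (does (h ≟ k))) (hookLen-first-row p ps c))) compare
  where
  open ≡-Reasoning
  n = length ps
  N = p + n
  compare : ∑ p (λ c → bit (does (p ∸ c + colLength ps c ≟ k))) ≡
            ∑ M (λ i → bit (not (beads ps i) ∧ does (k + i ≟ N)))
  compare with k ≤? N
  -- First-row hook lengths are at most `N`, so both sides vanish when `k` exceeds `N`.
  ... | no k≰N = trans
          (∑-zero p (λ c _ → cong bit (dec-false (p ∸ c + colLength ps c ≟ k)
            (<⇒≢ (≤-<-trans (+-mono-≤ (m∸n≤m p c) (colLength-≤ ps c)) (≰⇒> k≰N))))))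
          (sym (∑-zero M (λ i _ → trans
            (cong (λ y → bit (not (beads ps i) ∧ y))
              (dec-false (k + i ≟ N) (λ eq → k≰N (≤-trans (m≤m+n k i) (≤-reflexive eq)))))
            (cong bit (∧-zeroʳ (not (beads ps i)))))))
  ... | yes k≤N with m≤n⇒∃[o]m+o≡n k≤N
  ...   | x , k+x≡N = begin
    ∑ p (λ c → bit (does (p ∸ c + colLength ps c ≟ k)))
      ≡⟨ ∑-cong< p (λ c c<p → cong bit (does-⇔ (mk⇔ (to c c<p) (from c c<p))
            (p ∸ c + colLength ps c ≟ k) (c + n ≟ x + colLength ps c))) ⟩
    ∑ p (λ c → bit (does (c + n ≟ x + colLength ps c)))
      ≡⟨ +-cancelʳ-≡ (bit (beads ps x)) _ _
           (trans (gap-unique ps≤p ps↘ x<N) (sym (complement (beads ps x)))) ⟩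
    bit (not (beads ps x))
      ≡⟨ cong bit (∧-identityʳ (not (beads ps x))) ⟨
    bit (not (beads ps x) ∧ true)
      ≡⟨ cong (λ y → bit (not (beads ps x) ∧ y)) (dec-true (k + x ≟ N) k+x≡N) ⟨
    bit (not (beads ps x) ∧ does (k + x ≟ N))
      ≡⟨ ∑-single (<-trans x<N N<M) (λ i i≢x → trans
            (cong (λ y → bit (not (beads ps i) ∧ y))
              (dec-false (k + i ≟ N) (λ eq → i≢x (+-cancelˡ-≡ k i x (trans eq (sym k+x≡N))))))
            (cong bit (∧-zeroʳ (not (beads ps i))))) ⟨
    ∑ M (λ i → bit (not (beads ps i) ∧ does (k + i ≟ N))) ∎
    where
    x<N : x < N
    x<N = subst (x <_) k+x≡N (m<n+m x 0<k)
    complement : ∀ y → bit (not y) + bit y ≡ 1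
    complement true  = refl
    complement false = refl
    shuffle₁ : ∀ a c n → a + (c + n) ≡ c + a + n
    shuffle₁ = solve-∀
    shuffle₂ : ∀ a x l → a + (x + l) ≡ a + l + x
    shuffle₂ = solve-∀
    N≡ : ∀ c → c < p → p ∸ c + (c + n) ≡ k + x
    N≡ c c<p = trans (shuffle₁ (p ∸ c) c n) (trans (cong (_+ n) (m+[n∸m]≡n (<⇒≤ c<p))) (sym k+x≡N))
    to : ∀ c → c < p → p ∸ c + colLength ps c ≡ k → c + n ≡ x + colLength ps c
    to c c<p eq = +-cancelˡ-≡ (p ∸ c) _ _
      (trans (N≡ c c<p) (trans (cong (_+ x) (sym eq)) (sym (shuffle₂ (p ∸ c) x _))))
    from : ∀ c → c < p → c + n ≡ x + colLength ps c → p ∸ c + colLength ps c ≡ k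
    from c c<p eq = +-cancelʳ-≡ x _ _
      (trans (sym (shuffle₂ (p ∸ c) x _)) (trans (cong (p ∸ c +_) (sym eq)) (N≡ c c<p)))

-- Induction on the rows: the hooks of the first row are those whose upper end is the new top bead,
-- and the lower rows keep their hook lengths. The window `M` stays fixed throughout.
countHooks-beads : ∀ {k p ps M} → 0 < k → All (_≤ p) ps → AllPairs _≥_ ps → p + length ps ≤ M →
  countHooks k ps ≡ hookCount k M (beads ps)
countHooks-beads {ps = []} {M} 0<k [] [] _ = sym (∑-zero M (λ _ _ → refl))
countHooks-beads {k} {ps = q ∷ qs} {M} 0<k (q≤p ∷ _) (qs≤q ∷ qs↘) p+n≤M = begin
  countHooks k (q ∷ qs)
    ≡⟨ count-∷ (λ u → hookLen (q ∷ qs) u ≟ k) q qs ⟩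
  ∑ q (λ c → bit (does (hookLen (q ∷ qs) (0 , c) ≟ k))) +
  length (filter (λ u → hookLen (q ∷ qs) (map₁ suc u) ≟ k) (diagram qs))
    ≡⟨ cong₂ _+_ (first-row-hooks 0<k qs≤q qs↘ q+n<M) (cong length (filter-≐ _ _
         ((λ {u} → trans (sym (hookLen-suc-row q qs u))) , λ {u} → trans (hookLen-suc-row q qs u))
         (diagram qs))) ⟩
  ∑ M (λ i → bit (not (beads qs i) ∧ does (k + i ≟ q + length qs))) + countHooks k qs
    ≡⟨ cong (∑ M (λ i → bit (not (beads qs i) ∧ does (k + i ≟ q + length qs))) +_)
         (countHooks-beads 0<k qs≤q qs↘ (<⇒≤ q+n<M)) ⟩
  ∑ M (λ i → bit (not (beads qs i) ∧ does (k + i ≟ q + length qs))) + hookCount k M (beads qs)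
    ≡⟨ ∑-distrib-+ M _ _ ⟨
  ∑ M (λ i → bit (not (beads qs i) ∧ does (k + i ≟ q + length qs)) + bit (hook k (beads qs) i))
    ≡⟨ ∑-cong M (λ i → sym (beads-∷-hook qs≤q qs↘ 0<k i)) ⟩
  hookCount k M (beads (q ∷ qs)) ∎
  where
  open ≡-Reasoning
  q+n<M : q + length qs < M
  q+n<M = drop-head-< q≤p p+n≤M

-- From bead sums to weights.

beads-count : ∀ {p ps M} → All (_≤ p) ps → AllPairs _≥_ ps → p + length ps ≤ M →
              ∑ M (bit ∘ beads ps) ≡ length ps
beads-count {ps = []} {M} [] [] _ = ∑-zero M (λ _ _ → refl)
beads-count {ps = q ∷ qs} {M} (q≤p ∷ _) (qs≤q ∷ qs↘) p+n≤M = begin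
  ∑ M (bit ∘ beads (q ∷ qs))                    ≡⟨ ∑-cong M (λ i → sym (*-identityʳ (bit (beads (q ∷ qs) i)))) ⟩
  ∑ M (λ i → bit (beads (q ∷ qs) i) * 1)        ≡⟨ beads-∷-∑ qs≤q qs↘ q+n<M (λ _ → 1) ⟩
  suc (∑ M (λ i → bit (beads qs i) * 1))        ≡⟨ cong suc (∑-cong M (λ i → *-identityʳ (bit (beads qs i)))) ⟩
  suc (∑ M (bit ∘ beads qs))                    ≡⟨ cong suc (beads-count qs≤q qs↘ (<⇒≤ q+n<M)) ⟩
  suc (length qs)                               ∎
  where
  open ≡-Reasoning
  q+n<M = drop-head-< q≤p p+n≤M

beads-sum : ∀ {p ps M} → All (_≤ p) ps → AllPairs _≥_ ps → p + length ps ≤ M →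
            ∑ M (λ i → bit (beads ps i) * i) ≡ ∑ (length ps) id + sum ps
beads-sum {ps = []} {M} [] [] _ = ∑-zero M (λ _ _ → refl)
beads-sum {ps = q ∷ qs} {M} (q≤p ∷ _) (qs≤q ∷ qs↘) p+n≤M = begin
  ∑ M (λ i → bit (beads (q ∷ qs) i) * i)          ≡⟨ beads-∷-∑ qs≤q qs↘ q+n<M id ⟩
  q + n + ∑ M (λ i → bit (beads qs i) * i)        ≡⟨ cong (q + n +_) (beads-sum qs≤q qs↘ (<⇒≤ q+n<M)) ⟩
  q + n + (∑ n id + sum qs)                       ≡⟨ shuffle q n (∑ n id) (sum qs) ⟩
  n + ∑ n id + (q + sum qs)                       ≡⟨ cong (_+ (q + sum qs)) (∑-suc n) ⟨
  ∑ n suc + (q + sum qs)                          ∎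
  where
  open ≡-Reasoning
  n = length qs
  q+n<M = drop-head-< q≤p p+n≤M
  shuffle : ∀ q n s t → q + n + (s + t) ≡ n + s + (q + t)
  shuffle = solve-∀

-- The bead sum exceeds the weight by 0 + 1 + ... + (n - 1), the very term that `beads-≥` has on its
-- left, so it cancels.
weight-≥ : ∀ {k} r l → 0 < k → ∀ {p ps} → All (_≤ p) ps → AllPairs _≥_ ps →
           r + l * k ≤ countHooks k ps → r * (suc l * k) + sum (staircase k l) ≤ sum ps
weight-≥ {k} r l 0<k {p} {ps} ps≤p ps↘ hooks = +-cancelˡ-≤ (∑ n id) _ _ (begin
  ∑ n id + s                        ≡⟨ cong (λ n → ∑ n id + s) (beads-count ps≤p ps↘ ≤-refl) ⟨
  ∑ (∑ M (bit ∘ beads ps)) id + s   ≤⟨ beads-≥ k r l (beads ps) (beads-bounded ps≤p ps↘)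
                                         (≤-trans hooks (≤-reflexive (countHooks-beads 0<k ps≤p ps↘ ≤-refl))) ⟩
  ∑ M (λ i → bit (beads ps i) * i)  ≡⟨ beads-sum ps≤p ps↘ ≤-refl ⟩
  ∑ n id + sum ps                   ∎)
  where
  open ≤-Reasoning
  n = length ps
  M = p + n
  s = r * (suc l * k) + sum (staircase k l)

-- The closed formula for `t`.

-- The staircase itself weighs `(suc l C 2) * k ^ 2`, and twice that binomial is `l * suc l`. The
-- induction uses Pascal's rule.
sum-staircase : ∀ k l → sum (staircase k l) + (suc l C 2) * k ^ 2 ≡ l * suc l * k ^ 2
sum-staircase k zero    = refl
sum-staircase k (suc l) = begin
  sum (staircase k (suc l)) + (suc (suc l) C 2) * k ^ 2
    ≡⟨ cong₂ _+_ (sum-replicate-++ k (suc l * k) (staircase k l))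
                 (cong (_* k ^ 2) (trans (sym (nCk+nC[k+1]≡[n+1]C[k+1] (suc l) 1))
                                         (cong (_+ suc l C 2) (nC1≡n (suc l))))) ⟩
  k * (suc l * k) + sum (staircase k l) + (suc l + suc l C 2) * k ^ 2
    ≡⟨ regroup k l (sum (staircase k l)) (suc l C 2) ⟩
  sum (staircase k l) + (suc l C 2) * k ^ 2 + 2 * (suc l * k ^ 2)
    ≡⟨ cong (_+ 2 * (suc l * k ^ 2)) (sum-staircase k l) ⟩
  l * suc l * k ^ 2 + 2 * (suc l * k ^ 2)
    ≡⟨ finish l (k ^ 2) ⟩
  suc l * suc (suc l) * k ^ 2 ∎
  where
  open ≡-Reasoning
  -- `k * (k * 1)` is what `k ^ 2` computes to.
  regroup : ∀ k l s c → k * (suc l * k) + s + (suc l + c) * (k * (k * 1)) ≡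
                        s + c * (k * (k * 1)) + 2 * (suc l * (k * (k * 1)))
  regroup = solve-∀
  finish : ∀ l x → l * suc l * x + 2 * (suc l * x) ≡ suc l * suc (suc l) * x
  finish = solve-∀

-- The subtracted term stands on the left to stay within the naturals; the identity also shows that
-- the difference is not negative.
t-formula : ∀ m k .{{_ : NonZero k}} →
            t m k + ((m / k + 1) C 2) * k ^ 2 ≡ m * (m / k + 1) * k
t-formula m k = begin
  t m k + ((l + 1) C 2) * k ^ 2
    ≡⟨ cong₂ (λ s j → s + (j C 2) * k ^ 2)
             (sum-replicate-++ r (suc l * k) (staircase k l)) (+-comm l 1) ⟩
  r * (suc l * k) + sum (staircase k l) + (suc l C 2) * k ^ 2
    ≡⟨ +-assoc (r * (suc l * k)) _ _ ⟩
  r * (suc l * k) + (sum (staircase k l) + (suc l C 2) * k ^ 2)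
    ≡⟨ cong (r * (suc l * k) +_) (sum-staircase k l) ⟩
  r * (suc l * k) + l * suc l * k ^ 2
    ≡⟨ factor r l k ⟩
  (r + l * k) * (l + 1) * k
    ≡⟨ cong (λ m → m * (l + 1) * k) (m≡m%n+[m/n]*n m k) ⟨
  m * (l + 1) * k ∎
  where
  open ≡-Reasoning
  l = m / k
  r = m % k
  factor : ∀ r l k → r * (suc l * k) + l * suc l * (k * (k * 1)) ≡ (r + l * k) * (l + 1) * k
  factor = solve-∀

open import Data.Integer.Base using (+_; _-_; _⊖_)

theorem3p1 : (m k : ℕ) .{{_ : NonZero k}} →
    ((λ′ : Partition) → α k λ′ ≡ m → weight λ′ ≥ t m k) ×
    (+ (t m k) ≡ + (m * (m / k + 1) * k) - + (((m / k + 1) C 2) * k ^ 2))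
theorem3p1 m k = minimal , formula
  where
  l = m / k
  r = m % k
  A = m * (l + 1) * k
  B = ((l + 1) C 2) * k ^ 2

  minimal : (λ′ : Partition) → α k λ′ ≡ m → weight λ′ ≥ t m k
  minimal (mkPartition ps ps↘ _) α≡m = begin
    t m k                                   ≡⟨ sum-replicate-++ r (suc l * k) (staircase k l) ⟩
    -- The sum of the parts serves as their common upper bound, also for the empty partition.
    r * (suc l * k) + sum (staircase k l)   ≤⟨ weight-≥ r l (>-nonZero⁻¹ k) (parts-≤-sum ps) ps↘′ hooks ⟩
    sum ps                                  ∎
    where
    open ≤-Reasoning
    ps↘′ : AllPairs _≥_ ps
    ps↘′ = Linked⇒AllPairs (λ p≥q q≥r → ≤-trans q≥r p≥q) ps↘
    hooks : r + l * k ≤ countHooks k ps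
    hooks = ≤-reflexive (trans (sym (m≡m%n+[m/n]*n m k)) (sym α≡m))
    parts-≤-sum : ∀ ps → All (_≤ sum ps) ps
    parts-≤-sum []       = []
    parts-≤-sum (p ∷ ps) =
      m≤m+n p (sum ps) ∷ All.map (λ q≤ → ≤-trans q≤ (m≤n+m (sum ps) p)) (parts-≤-sum ps)

  formula : + (t m k) ≡ + A - + B
  formula = begin
    + (t m k)          ≡⟨ cong +_ (m+n∸n≡m (t m k) B) ⟨
    + (t m k + B ∸ B)  ≡⟨ cong (λ a → + (a ∸ B)) (t-formula m k) ⟩
    -- `B ≤ A` follows from `t-formula`, so truncated and integer subtraction agree.
    + (A ∸ B)          ≡⟨ ⊖-≥ (subst (B ≤_) (t-formula m k) (m≤n+m B (t m k))) ⟨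
    A ⊖ B              ≡⟨ m-n≡m⊖n A B ⟨
    + A - + B          ∎
    where open ≡-Reasoning
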